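{- Let $G$ be a Polish group and let $\varphi(\bar{x},\bar{y})$ be a quantifier-free formula in the language of group theory, where $\bar{x},\bar{y}$ are finite tuples of variables. Then $\varphi(\bar{x},\bar{y})$ does not define the $\aleph_1$-half graph in $G$; that is, there do not exist sequences $(\bar{a}_\alpha : \alpha<\aleph_1)$ and $(\bar{b}_\beta : \beta<\aleph_1)$ of tuples of elements of $G$, with $\bar{a}_\alpha$ of the length of $\bar{x}$ and $\bar{b}_\beta$ of the length of $\bar{y}$, such that for all $\alpha,\beta<\aleph_1$: $G\models\varphi(\bar{a}_\alpha,\bar{b}_\beta)$ if and only if $\alpha<\beta$.
   Context: The $\aleph_1$-half graph $\Gamma(\aleph_1)$ is the graph on vertex set $\{a_\alpha : \alpha<\aleph_1\}\cup\{b_\beta : \beta<\aleph_1\}$ with edge relation $a_\alpha \mathrel{E} b_\beta$ if and only if $\alpha<\beta$. The language of group theory is $\{e,\cdot,(\ )^{ -1}\}$. A Polish group is a topological group whose topology is separable and completely metrizable. -}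

module Defs where

open import Algebra.Bundles using (Group)
open import Data.Empty.Polymorphic using (⊥)
open import Data.Fin.Base using (Fin)
open import Data.Nat.Base as ℕ using (ℕ)
import Data.Nat.Properties as ℕ
open import Data.Product using (Σ; ∃; ∃₂; _×_; _,_; proj₁)
open import Data.Product.Relation.Binary.Pointwise.NonDependent using (×-setoid)
open import Data.Rational.Base as ℚ using (ℚ; 0ℚ; ½)
import Data.Rational.Properties as ℚ
open import Data.Rational.Solver using (module +-*-Solver)
open import Data.Sum.Base using (_⊎_; inj₁; inj₂; [_,_])
open import Data.Unit.Polymorphic using (⊤; tt)
import Data.Vec.Functional.Relation.Binary.Equality.Setoid as VecEq
open import Function.Bundles using (Func; Injection; _⇔_)
open import Function.Metric.Structures using (IsGeneralMetric)
open import Induction.WellFounded using (WellFounded)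
open import Level using (Level; _⊔_; 0ℓ) renaming (suc to lsuc)
open import Relation.Binary.Bundles using (Setoid; StrictTotalOrder)
import Relation.Binary.Construct.On as On
open import Relation.Binary.Definitions using (_Respects_)
open import Relation.Binary.PropositionalEquality as ≡ using (_≡_)
open import Relation.Binary.Structures using (IsEquivalence; IsPartialOrder)
open import Relation.Nullary.Negation using (¬_)
open import Relation.Unary using (Pred; _∈_; _≐_; _∩_; _⊢_; ⋃; Satisfiable)

private
  variable
    c ℓ p o₁ o₂ o₃ : Level

------------------------------------------------------------------------
-- Real numbers, as Cauchy sequences of rationals up to null sequences

Eventually : Pred ℕ p → Set p
Eventually P = ∃ λ N → ∀ n → N ℕ.≤ n → P n

record ℝ : Set where
  field
    seq    : ℕ → ℚ
    cauchy : ∀ ε → 0ℚ ℚ.< ε →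
             ∃ λ N → ∀ m n → N ℕ.≤ m → N ℕ.≤ n → ℚ.∣ seq m ℚ.- seq n ∣ ℚ.< ε

open ℝ

infix 4 _≃_ _≤ℝ_ _<ℝ_

_≃_ : ℝ → ℝ → Set
x ≃ y = ∀ ε → 0ℚ ℚ.< ε → Eventually λ n → ℚ.∣ seq x n ℚ.- seq y n ∣ ℚ.< ε

_≤ℝ_ : ℝ → ℝ → Set
x ≤ℝ y = ∀ ε → 0ℚ ℚ.< ε → Eventually λ n → seq x n ℚ.- seq y n ℚ.< ε

_<ℝ_ : ℝ → ℝ → Set
x <ℝ y = ∃ λ ε → 0ℚ ℚ.< ε × Eventually λ n → seq x n ℚ.+ ε ℚ.< seq y n

private
  open +-*-Solver using (solve; con; _:+_; _:*_; _:-_; :-_; _:=_)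

  halve : ∀ ε → ½ ℚ.* ε ℚ.+ ½ ℚ.* ε ≡ ε
  halve = solve 1 (λ ε → con ½ :* ε :+ con ½ :* ε := ε) ≡.refl

  half-pos : ∀ {ε} → 0ℚ ℚ.< ε → 0ℚ ℚ.< ½ ℚ.* ε
  half-pos = ℚ.*-monoʳ-<-pos ½

  half+half : ∀ {u v} ε → u ℚ.< ½ ℚ.* ε → v ℚ.< ½ ℚ.* ε → u ℚ.+ v ℚ.< ε
  half+half ε u< v< = ≡.subst (_ ℚ.<_) (halve ε) (ℚ.+-mono-< u< v<)

  interchange : ∀ a b c d → (a ℚ.- c) ℚ.+ (b ℚ.- d) ≡ (a ℚ.+ b) ℚ.- (c ℚ.+ d)
  interchange = solve 4
    (λ a b c d → (a :- c) :+ (b :- d) := (a :+ b) :- (c :+ d)) ≡.refl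

  telescope : ∀ a b c → (a ℚ.- b) ℚ.+ (b ℚ.- c) ≡ a ℚ.- c
  telescope = solve 3 (λ a b c → (a :- b) :+ (b :- c) := a :- c) ≡.refl

  neg-diff : ∀ a b → ℚ.- (a ℚ.- b) ≡ b ℚ.- a
  neg-diff = solve 2 (λ a b → :- (a :- b) := b :- a) ≡.refl

  ∣diff∣-comm : ∀ a b → ℚ.∣ a ℚ.- b ∣ ≡ ℚ.∣ b ℚ.- a ∣
  ∣diff∣-comm a b =
    ≡.trans (≡.sym (ℚ.∣-p∣≡∣p∣ (a ℚ.- b))) (≡.cong ℚ.∣_∣ (neg-diff a b))

  p≤∣p∣ : ∀ q → q ℚ.≤ ℚ.∣ q ∣
  p≤∣p∣ q with ℚ.≤-total 0ℚ q
  ... | inj₁ 0≤q = ℚ.≤-reflexive (≡.sym (ℚ.0≤p⇒∣p∣≡p 0≤q))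
  ... | inj₂ q≤0 = ℚ.≤-trans q≤0 (ℚ.0≤∣p∣ q)

  ∣∣-lub : ∀ {q ε} → q ℚ.< ε → ℚ.- q ℚ.< ε → ℚ.∣ q ∣ ℚ.< ε
  ∣∣-lub {q} q<ε -q<ε with ℚ.∣p∣≡p∨∣p∣≡-p q
  ... | inj₁ eq = ≡.subst (ℚ._< _) (≡.sym eq) q<ε
  ... | inj₂ eq = ≡.subst (ℚ._< _) (≡.sym eq) -q<ε

  ∣+∣-< : ∀ u v {w} ε → u ℚ.+ v ≡ w →
          ℚ.∣ u ∣ ℚ.< ½ ℚ.* ε → ℚ.∣ v ∣ ℚ.< ½ ℚ.* ε → ℚ.∣ w ∣ ℚ.< ε
  ∣+∣-< u v ε ≡.refl u< v< =
    ℚ.≤-<-trans (ℚ.∣p+q∣≤∣p∣+∣q∣ u v) (half+half ε u< v<)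

  both : {P Q R : Pred ℕ p} → (∀ n → P n → Q n → R n) →
         Eventually P → Eventually Q → Eventually R
  both f (M , P!) (N , Q!) = M ℕ.⊔ N , λ n M⊔N≤n → f n
    (P! n (ℕ.≤-trans (ℕ.m≤m⊔n M N) M⊔N≤n))
    (Q! n (ℕ.≤-trans (ℕ.m≤n⊔m M N) M⊔N≤n))

  each : {P Q : Pred ℕ p} → (∀ n → P n → Q n) → Eventually P → Eventually Q
  each f (N , P!) = N , λ n N≤n → f n (P! n N≤n)

0ℝ : ℝ
0ℝ .seq _ = 0ℚ
0ℝ .cauchy ε 0<ε = 0 , λ _ _ _ _ → 0<ε

infixl 6 _+ℝ_

_+ℝ_ : ℝ → ℝ → ℝ
(x +ℝ y) .seq n = seq x n ℚ.+ seq y n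
(x +ℝ y) .cauchy ε 0<ε
  with M , x! ← cauchy x (½ ℚ.* ε) (half-pos 0<ε)
     | N , y! ← cauchy y (½ ℚ.* ε) (half-pos 0<ε)
  = M ℕ.⊔ N , λ m n ≤m ≤n →
      ∣+∣-< (seq x m ℚ.- seq x n) (seq y m ℚ.- seq y n) ε
        (interchange (seq x m) (seq y m) (seq x n) (seq y n))
        (x! m n (ℕ.≤-trans (ℕ.m≤m⊔n M N) ≤m) (ℕ.≤-trans (ℕ.m≤m⊔n M N) ≤n))
        (y! m n (ℕ.≤-trans (ℕ.m≤n⊔m M N) ≤m) (ℕ.≤-trans (ℕ.m≤n⊔m M N) ≤n))

≃-isEquivalence : IsEquivalence _≃_
≃-isEquivalence = record
  { refl  = λ {x} ε 0<ε → 0 , λ n _ →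
      ≡.subst (λ q → ℚ.∣ q ∣ ℚ.< ε) (≡.sym (ℚ.+-inverseʳ (seq x n))) 0<ε
  ; sym   = λ {x} {y} x≃y ε 0<ε → each
      (λ n → ≡.subst (ℚ._< ε) (∣diff∣-comm (seq x n) (seq y n))) (x≃y ε 0<ε)
  ; trans = λ {x} {y} {z} x≃y y≃z ε 0<ε → both
      (λ n → ∣+∣-< (seq x n ℚ.- seq y n) (seq y n ℚ.- seq z n) ε
        (telescope (seq x n) (seq y n) (seq z n)))
      (x≃y _ (half-pos 0<ε)) (y≃z _ (half-pos 0<ε))
  }

≤ℝ-isPartialOrder : IsPartialOrder _≃_ _≤ℝ_
≤ℝ-isPartialOrder = record
  { isPreorder = record
    { isEquivalence = ≃-isEquivalence
    ; reflexive     = λ x≃y ε 0<ε →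
        each (λ n → ℚ.≤-<-trans (p≤∣p∣ _)) (x≃y ε 0<ε)
    ; trans         = λ {x} {y} {z} x≤y y≤z ε 0<ε → both
        (λ n x≲y y≲z → ≡.subst (ℚ._< ε)
          (telescope (seq x n) (seq y n) (seq z n)) (half+half ε x≲y y≲z))
        (x≤y _ (half-pos 0<ε)) (y≤z _ (half-pos 0<ε))
    }
  ; antisym = λ {x} {y} x≤y y≤x ε 0<ε → both
      (λ n x≲y y≲x → ∣∣-lub x≲y
        (≡.subst (ℚ._< ε) (≡.sym (neg-diff (seq x n) (seq y n))) y≲x))
      (x≤y ε 0<ε) (y≤x ε 0<ε)
  }

------------------------------------------------------------------------
-- Countability

-- Finite sets count as countable.
Countable : Setoid c ℓ → Set (c ⊔ ℓ)
Countable S = Injection S (≡.setoid ℕ)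

subsetoid : (S : Setoid c ℓ) → Pred (Setoid.Carrier S) p → Setoid (c ⊔ p) ℓ
subsetoid S D = On.setoid {B = Σ (Setoid.Carrier S) D} S proj₁

-- A well-order of type ℵ₁: it is uncountable, while all smaller
-- ordinals, i.e. its proper initial segments, are countable.
record IsAleph₁ (Ω : StrictTotalOrder o₁ o₂ o₃) : Set (o₁ ⊔ o₂ ⊔ o₃) where
  open StrictTotalOrder Ω
  field
    wellFounded       : WellFounded _<_
    segmentsCountable : ∀ α → Countable (subsetoid Eq.setoid (_< α))
    uncountable       : ¬ Countable Eq.setoid

------------------------------------------------------------------------
-- Topological spaces on setoids

-- The empty set is open as the union of the empty family.  By excluded
-- middle, index types I at the level of the subsets themselves reach the
-- union of any collection of open sets: index it by its own points.
record Topology (S : Setoid c ℓ) : Set (lsuc (lsuc (c ⊔ ℓ))) where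
  open Setoid S
  field
    Open      : Pred (Pred Carrier (c ⊔ ℓ)) (lsuc (c ⊔ ℓ))
    respects  : ∀ {U} → Open U → U Respects _≈_
    resp-≐    : ∀ {U V} → U ≐ V → Open U → Open V
    open-full : Open (λ _ → ⊤)
    open-∩    : ∀ {U V} → Open U → Open V → Open (U ∩ V)
    open-⋃    : ∀ {I : Set (c ⊔ ℓ)} {U : I → Pred Carrier (c ⊔ ℓ)} →
                (∀ i → Open (U i)) → Open (⋃ I U)

open Topology using (Open)

Continuous : {S T : Setoid c ℓ} → Topology S → Topology T →
             (Setoid.Carrier S → Setoid.Carrier T) → Set (lsuc (c ⊔ ℓ))
Continuous σ τ f = ∀ {V} → Open τ V → Open σ (f ⊢ V)

infixr 2 _×ᵗ_

_×ᵗ_ : {S T : Setoid c ℓ} → Topology S → Topology T → Topology (×-setoid S T)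
_×ᵗ_ {c} {ℓ} {S} {T} σ τ = record
  { Open      = λ W → ∀ x y → (x , y) ∈ W → Box W x y
  ; respects  = λ W! {(x , y)} (x≈ , y≈) xy∈W →
      let _ , _ , U! , V! , x∈U , y∈V , U×V⊆W = W! x y xy∈W
      in  U×V⊆W (σ.respects U! x≈ x∈U) (τ.respects V! y≈ y∈V)
  ; resp-≐    = λ (W⊆W′ , W′⊆W) W! x y xy∈W′ →
      let U , V , U! , V! , x∈U , y∈V , U×V⊆W = W! x y (W′⊆W xy∈W′)
      in  U , V , U! , V! , x∈U , y∈V , λ x∈ y∈ → W⊆W′ (U×V⊆W x∈ y∈)
  ; open-full = λ x y _ → _ , _ , σ.open-full , τ.open-full , tt , tt , λ _ _ → tt
  ; open-∩    = λ W! W′! x y (xy∈W , xy∈W′) →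
      let _ , _ , U!  , V!  , x∈U  , y∈V  , U×V⊆W  = W!  x y xy∈W
          _ , _ , U′! , V′! , x∈U′ , y∈V′ , U′×V′⊆W′ = W′! x y xy∈W′
      in  _ , _ , σ.open-∩ U! U′! , τ.open-∩ V! V′! , (x∈U , x∈U′) , (y∈V , y∈V′)
        , λ (x∈ , x∈′) (y∈ , y∈′) → U×V⊆W x∈ y∈ , U′×V′⊆W′ x∈′ y∈′
  ; open-⋃    = λ W! x y (i , xy∈W) →
      let U , V , U! , V! , x∈U , y∈V , U×V⊆W = W! i x y xy∈W
      in  U , V , U! , V! , x∈U , y∈V , λ x∈ y∈ → i , U×V⊆W x∈ y∈
  }
  where
  module σ = Topology σ
  module τ = Topology τ

  Box : Pred (Setoid.Carrier (×-setoid S T)) (c ⊔ ℓ) →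
        Setoid.Carrier S → Setoid.Carrier T → Set (lsuc (c ⊔ ℓ))
  Box W x y = ∃₂ λ U V → Open σ U × Open τ V × x ∈ U × y ∈ V ×
    (∀ {x′ y′} → x′ ∈ U → y′ ∈ V → (x′ , y′) ∈ W)

module _ {S : Setoid c ℓ} (τ : Topology S) where
  open Setoid S

  Dense : Pred Carrier (c ⊔ ℓ) → Set (lsuc (c ⊔ ℓ))
  Dense D = ∀ {U} → Open τ U → Satisfiable U → Satisfiable (U ∩ D)

  Separable : Set (lsuc (c ⊔ ℓ))
  Separable = ∃ λ D → Countable (subsetoid S D) × Dense D

------------------------------------------------------------------------
-- Metrics

module _ (S : Setoid c ℓ) (d : Setoid.Carrier S → Setoid.Carrier S → ℝ) where
  open Setoid S

  IsMetric : Set (c ⊔ ℓ)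
  IsMetric = IsGeneralMetric _≈_ _≃_ _≤ℝ_ 0ℝ _+ℝ_ d

  IsCauchy : (ℕ → Carrier) → Set
  IsCauchy s = ∀ ε → 0ℝ <ℝ ε →
    ∃ λ N → ∀ m n → N ℕ.≤ m → N ℕ.≤ n → d (s m) (s n) <ℝ ε

  ConvergesTo : (ℕ → Carrier) → Carrier → Set
  ConvergesTo s x = ∀ ε → 0ℝ <ℝ ε → Eventually λ n → d (s n) x <ℝ ε

  Complete : Set c
  Complete = ∀ s → IsCauchy s → ∃ (ConvergesTo s)

  MetricOpen : Pred (Pred Carrier (c ⊔ ℓ)) (c ⊔ ℓ)
  MetricOpen U = ∀ x → x ∈ U → ∃ λ ε → 0ℝ <ℝ ε × (∀ y → d x y <ℝ ε → y ∈ U)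

CompletelyMetrizable : {S : Setoid c ℓ} → Topology S → Set (lsuc (c ⊔ ℓ))
CompletelyMetrizable {S = S} τ = ∃ λ d →
  IsMetric S d × Complete S d × (∀ U → Open τ U ⇔ MetricOpen S d U)

------------------------------------------------------------------------
-- Polish groups

record IsTopologicalGroup (G : Group c ℓ) (τ : Topology (Group.setoid G))
         : Set (lsuc (c ⊔ ℓ)) where
  open Group G
  field
    ∙-continuous  : Continuous (τ ×ᵗ τ) τ (λ (x , y) → x ∙ y)
    ⁻¹-continuous : Continuous τ τ _⁻¹

record PolishGroup c ℓ : Set (lsuc (lsuc (c ⊔ ℓ))) where
  field
    group                : Group c ℓ
    topology             : Topology (Group.setoid group)
    isTopologicalGroup   : IsTopologicalGroup group topology
    separable            : Separable topology
    completelyMetrizable : CompletelyMetrizable topology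

------------------------------------------------------------------------
-- Quantifier-free formulas in the language of groups

infixl 7 _·_
infix  8 _⁻¹
infix  5 _==_
infix  4 ¬′_
infixr 3 _∧′_
infixr 2 _∨′_
infixr 1 _→′_

data Term (V : Set) : Set where
  var : V → Term V
  e   : Term V
  _·_ : Term V → Term V → Term V
  _⁻¹ : Term V → Term V

data QFFormula (V : Set) : Set where
  _==_           : Term V → Term V → QFFormula V
  ⊤′ ⊥′          : QFFormula V
  ¬′_            : QFFormula V → QFFormula V
  _∧′_ _∨′_ _→′_ : QFFormula V → QFFormula V → QFFormula V

module Semantics (G : Group c ℓ) where
  private module G = Group G

  ⟦_⟧ : {V : Set} → Term V → (V → G.Carrier) → G.Carrier
  ⟦ var v ⟧ ρ = ρ v
  ⟦ e     ⟧ ρ = G.ε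
  ⟦ s · t ⟧ ρ = ⟦ s ⟧ ρ G.∙ ⟦ t ⟧ ρ
  ⟦ t ⁻¹  ⟧ ρ = ⟦ t ⟧ ρ G.⁻¹

  Sat : {V : Set} → QFFormula V → (V → G.Carrier) → Set ℓ
  Sat (s == t) ρ = ⟦ s ⟧ ρ G.≈ ⟦ t ⟧ ρ
  Sat ⊤′       ρ = ⊤
  Sat ⊥′       ρ = ⊥
  Sat (¬′ φ)   ρ = ¬ Sat φ ρ
  Sat (φ ∧′ ψ) ρ = Sat φ ρ × Sat ψ ρ
  Sat (φ ∨′ ψ) ρ = Sat φ ρ ⊎ Sat ψ ρ
  Sat (φ →′ ψ) ρ = Sat φ ρ → Sat ψ ρ

-- The variables inj₁ i and inj₂ j stand for xᵢ and yⱼ.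
DefinesHalfGraph : (G : Group c ℓ) (Ω : StrictTotalOrder o₁ o₂ o₃) {m n : ℕ} →
                   QFFormula (Fin m ⊎ Fin n) → Set (c ⊔ ℓ ⊔ o₁ ⊔ o₂ ⊔ o₃)
DefinesHalfGraph G Ω {m} {n} φ =
  Σ (Func Ω.Eq.setoid (≋-setoid m)) λ a →
  Σ (Func Ω.Eq.setoid (≋-setoid n)) λ b →
  ∀ α β → Sat φ [ Func.to a α , Func.to b β ] ⇔ (α Ω.< β)
  where
  module Ω = StrictTotalOrder Ω
  open VecEq (Group.setoid G) using (≋-setoid)
  open Semantics G using (Sat)

{-# OPTIONS --safe #-}
-- An equation between group words defines a closed set, so where it fails it
-- fails on an open box.  As G is second countable, from some index γ on every
-- open box around a_α contains cofinally many a_α′, and likewise for b.  By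
-- induction on φ, any pair of boxes catching cofinally many a_α and b_β shrinks
-- to such a pair on which φ has constant truth value for indices beyond γ:
-- either an equation holds throughout, or it fails somewhere and so on a smaller
-- box, which is again caught cofinally often.  But cofinal sets of indices
-- contain pairs with α < β as well as pairs with β ≤ α.
module Submission where

open import Defs
open import Axiom.ExcludedMiddle using (ExcludedMiddle)
open import Data.Fin.Base using (Fin)
open import Data.Nat.Base using (ℕ)
open import Data.Sum.Base using (_⊎_)
open import Level using (Level)
open import Relation.Binary.Bundles using (StrictTotalOrder)
open import Relation.Nullary.Negation using (¬_)

open import Algebra.Bundles using (Group)
import Algebra.Properties.Group as GroupProperties
open import Data.Empty using (⊥-elim)
open import Data.Integer.Base as ℤ using (+_)
open import Data.Nat.Base as ℕ using (zero; suc)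
import Data.Nat.Properties as ℕ
open import Data.Nat.Induction using (<-rec)
open import Data.Product using (Σ; ∃; ∃₂; _×_; _,_; proj₁; proj₂)
open import Data.Rational.Base as ℚ using (ℚ; 0ℚ; ½; mkℚ)
import Data.Rational.Properties as ℚ
open import Data.Rational.Solver using (module +-*-Solver)
open import Data.Sum.Base as Sum using (inj₁; inj₂; [_,_])
open import Data.Unit.Polymorphic using (⊤; tt)
open import Data.Vec.Base using (Vec; []; _∷_; lookup; tabulate)
open import Data.Vec.Properties using (lookup∘tabulate)
open import Function.Base using (_∘_)
open import Function.Bundles using (Func; Injection; Equivalence)
open import Function.Metric.Structures using (IsGeneralMetric)
open import Level using (Lift; lift; lower; _⊔_) renaming (suc to lsuc)
open import Relation.Binary.Bundles using (Setoid)
open import Relation.Binary.Definitions using (tri<; tri≈; tri>; _Respects_)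
open import Relation.Binary.PropositionalEquality as ≡ using (_≡_)
open import Relation.Binary.Structures using (IsEquivalence; IsPartialOrder)
open import Relation.Nullary using (yes; no)
open import Relation.Unary using (Pred; _∈_; _⊆_; _∩_)

open +-*-Solver using (solve; con; _:+_; _:*_; _:-_; _:=_)
open ℝ using (seq; cauchy)
open Topology using (Open)

private
  variable
    c ℓ p o₁ o₂ o₃ : Level

-- Countability

least : (∀ {p} → ExcludedMiddle p) → {P : Pred ℕ p} → ∃ P →
        ∃ λ n → P n × (∀ k → P k → n ℕ.≤ k)
least {p} em {P} (n , Pn) = <-rec Least step n Pn
  where
  Least : Pred ℕ p
  Least n = P n → ∃ λ n → P n × (∀ k → P k → n ℕ.≤ k)

  step : ∀ n → (∀ {k} → k ℕ.< n → Least k) → Least n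
  step n rec Pn with em {P = ∃ λ k → k ℕ.< n × P k}
  ... | yes (k , k<n , Pk) = rec k<n Pk
  ... | no  minimal        = n , Pn , λ k Pk →
    ℕ.≮⇒≥ λ k<n → minimal (k , k<n , Pk)

-- Each element is coded by the least number related to it. A direct choice of code need not send
-- equal elements to equal numbers; the least one does, because equal elements are related to the
-- same numbers.
countable-by-relation : (∀ {p} → ExcludedMiddle p) → (S : Setoid c ℓ) →
  (R : Setoid.Carrier S → Pred ℕ p) →
  (∀ x → ∃ (R x)) →
  (∀ {k} → (λ x → R x k) Respects Setoid._≈_ S) →
  (∀ {x y k} → R x k → R y k → Setoid._≈_ S x y) →
  Countable S
countable-by-relation em S R total resp injective = record
  { to        = proj₁ ∘ code
  ; cong      = λ {x} {y} x≈y →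
      let _ , Rx , x-min = code x
          _ , Ry , y-min = code y
      in  ℕ.≤-antisym (x-min _ (resp (S.sym x≈y) Ry)) (y-min _ (resp x≈y Rx))
  ; injective = λ {x} {y} eq →
      injective (proj₁ (proj₂ (code x)))
                (≡.subst (R y) (≡.sym eq) (proj₁ (proj₂ (code y))))
  }
  where
  module S = Setoid S
  code = λ x → least em (total x)

-- The value is 2^m (2n + 1) - 1, so its parity tells whether `m` is zero and injectivity follows by
-- recursion.
pair : ℕ → ℕ → ℕ
pair zero    n = 2 ℕ.* n
pair (suc m) n = suc (2 ℕ.* pair m n)

pair-injective : ∀ {m n m′ n′} → pair m n ≡ pair m′ n′ → m ≡ m′ × n ≡ n′
pair-injective {zero} {n} {zero} {n′} eq = ≡.refl , ℕ.*-cancelˡ-≡ n n′ 2 eq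
pair-injective {zero} {n} {suc m′} {n′} eq = ⊥-elim (ℕ.even≢odd n (pair m′ n′) eq)
pair-injective {suc m} {n} {zero} {n′} eq =
  ⊥-elim (ℕ.even≢odd n′ (pair m n) (≡.sym eq))
pair-injective {suc m} {n} {suc m′} {n′} eq
  with m≡m′ , n≡n′ ← pair-injective {m} {n} {m′} {n′}
         (ℕ.*-cancelˡ-≡ _ _ 2 (ℕ.suc-injective eq))
  = ≡.cong suc m≡m′ , n≡n′

-- Real numbers

private
  ∧ᵉ-map : {P Q R : Pred ℕ p} → (∀ {n} → P n → Q n → R n) →
           Eventually P → Eventually Q → Eventually R
  ∧ᵉ-map f (M , P!) (N , Q!) = M ℕ.⊔ N , λ n M⊔N≤n → f
    (P! n (ℕ.≤-trans (ℕ.m≤m⊔n M N) M⊔N≤n))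
    (Q! n (ℕ.≤-trans (ℕ.m≤n⊔m M N) M⊔N≤n))

  mapᵉ : {P Q : Pred ℕ p} → (∀ {n} → P n → Q n) → Eventually P → Eventually Q
  mapᵉ f (N , P!) = N , λ n N≤n → f (P! n N≤n)

  half-pos : ∀ {ε} → 0ℚ ℚ.< ε → 0ℚ ℚ.< ½ ℚ.* ε
  half-pos = ℚ.*-monoʳ-<-pos ½

  -- For linear arithmetic: a < b is the sum of the hypotheses, and the
  -- equation says y - x = b - a.
  <-linear : ∀ {a b} x y → a ℚ.< b → x ℚ.+ b ≡ y ℚ.+ a → x ℚ.< y
  <-linear {a} {b} x y a<b eq = ≡.subst₂ ℚ._<_
    (≡.trans (≡.cong (ℚ._- b) (≡.sym eq)) (cancel x b)) (cancel y b)
    (ℚ.+-monoˡ-< (ℚ.- b) (ℚ.+-monoʳ-< y a<b))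
    where
    cancel : ∀ x b → x ℚ.+ b ℚ.- b ≡ x
    cancel = solve 2 (λ x b → x :+ b :- b := x) ≡.refl

constℝ : ℚ → ℝ
constℝ q .seq _ = q
constℝ q .cauchy ε 0<ε = 0 , λ _ _ _ _ →
  ≡.subst (λ r → ℚ.∣ r ∣ ℚ.< ε) (≡.sym (ℚ.+-inverseʳ q)) 0<ε

constℝ-pos : ∀ {q} → 0ℚ ℚ.< q → 0ℝ <ℝ constℝ q
constℝ-pos {q} 0<q = ½ ℚ.* q , half-pos 0<q , 0 , λ _ _ →
  <-linear (0ℚ ℚ.+ ½ ℚ.* q) q (half-pos 0<q)
    (solve 1 (λ q → con 0ℚ :+ con ½ :* q :+ con ½ :* q := q :+ con 0ℚ) ≡.refl q)

≃⇒≤ : ∀ {u v} → u ≃ v → u ≤ℝ v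
≃⇒≤ {u} {v} = IsPartialOrder.reflexive ≤ℝ-isPartialOrder {u} {v}

≤-antisym : ∀ {u v} → u ≤ℝ v → v ≤ℝ u → u ≃ v
≤-antisym {u} {v} = IsPartialOrder.antisym ≤ℝ-isPartialOrder {u} {v}

<⇒≱ : ∀ {u v} → u <ℝ v → ¬ v ≤ℝ u
<⇒≱ {u} {v} (ε , 0<ε , u<v) v≤u = ℚ.<-irrefl ≡.refl (proj₂ absurd _ ℕ.≤-refl)
  where
  absurd : Eventually λ _ → 0ℚ ℚ.< 0ℚ
  absurd = ∧ᵉ-map
    (λ {n} h₁ h₂ → <-linear 0ℚ 0ℚ (ℚ.+-mono-< h₁ h₂)
      (solve 3 (λ u v ε → con 0ℚ :+ (v :+ ε) := con 0ℚ :+ (u :+ ε :+ (v :- u)))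
        ≡.refl (seq u n) (seq v n) ε))
    u<v (v≤u ε 0<ε)

<-respˡ-≃ : ∀ {u v r} → u ≃ v → u <ℝ r → v <ℝ r
<-respˡ-≃ {u} {v} {r} u≃v (ε , 0<ε , u<r) = ½ ℚ.* ε , half-pos 0<ε ,
  ∧ᵉ-map
    (λ {n} h₁ h₂ → <-linear (seq v n ℚ.+ ½ ℚ.* ε) (seq r n) (ℚ.+-mono-< h₁ h₂)
      (solve 4 (λ u v r ε →
          v :+ con ½ :* ε :+ (r :+ con ½ :* ε) := r :+ (u :+ ε :+ (v :- u)))
        ≡.refl (seq u n) (seq v n) (seq r n) ε))
    u<r (≃⇒≤ {v} {u} (IsEquivalence.sym ≃-isEquivalence {u} {v} u≃v)
      (½ ℚ.* ε) (half-pos 0<ε))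

≃0⇒<const : ∀ {u q} → u ≃ 0ℝ → 0ℚ ℚ.< q → u <ℝ constℝ q
≃0⇒<const {u} {q} u≃0 0<q = ½ ℚ.* q , half-pos 0<q ,
  mapᵉ (λ {n} h → <-linear (seq u n ℚ.+ ½ ℚ.* q) q h
      (solve 2 (λ u q → u :+ con ½ :* q :+ con ½ :* q := q :+ (u :- con 0ℚ))
        ≡.refl (seq u n) q))
    (≃⇒≤ {u} {0ℝ} u≃0 (½ ℚ.* q) (half-pos 0<q))

-- Abstract because unfolding arithmetic on ℚ is expensive.
abstract
  -- The radius `q` is half of a rational `η` that `ε` eventually exceeds. It is rational so that
  -- countably many radii suffice for `network`. Half of the gap `δ` absorbs the error in `≤ℝ`, the
  -- other half is the gap of the conclusion.
  <-halving : ∀ {ε} → 0ℝ <ℝ ε → ∃ λ q → 0ℚ ℚ.< q ×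
              (∀ {u v w} → u <ℝ constℝ q → v <ℝ constℝ q → w ≤ℝ u +ℝ v → w <ℝ ε)
  <-halving {ε} (η , 0<η , 0<ε) = ½ ℚ.* η , half-pos 0<η ,
    λ {u} {v} {w} (δ , 0<δ , u<) (δ′ , 0<δ′ , v<) w≤u+v → ½ ℚ.* δ , half-pos 0<δ ,
      ∧ᵉ-map
        (λ {n} (h₁ , h₂) (h₃ , h₄) →
          <-linear (seq w n ℚ.+ ½ ℚ.* δ) (seq ε n)
            (ℚ.+-mono-< h₁ (ℚ.+-mono-< h₂ (ℚ.+-mono-< h₃ (ℚ.+-mono-< h₄ 0<δ′))))
            (solve 7 (λ u v w ε η δ δ′ →
                w :+ con ½ :* δ
                    :+ (con ½ :* δ :+ (con ½ :* η :+ (con ½ :* η :+ (ε :+ δ′))))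
                  := ε :+ (w :- (u :+ v)
                    :+ (u :+ δ :+ (v :+ δ′ :+ (con 0ℚ :+ η :+ con 0ℚ)))))
              ≡.refl (seq u n) (seq v n) (seq w n) (seq ε n) η δ δ′))
        (∧ᵉ-map _,_ (w≤u+v (½ ℚ.* δ) (half-pos 0<δ)) u<)
        (∧ᵉ-map _,_ v< 0<ε)

  fraction : ℕ → ℕ → ℚ
  fraction a b = + a ℚ./ suc b

  fraction-surjective : ∀ {q} → 0ℚ ℚ.< q → ∃₂ λ a b → fraction a b ≡ q
  fraction-surjective {q@(mkℚ (+ a) b _)}      _ = a , b , ℚ.↥p/↧p≡p q
  fraction-surjective {mkℚ ℤ.-[1+ _ ] _ _} (ℚ.*<* ())

-- The rational gap in `u <ℝ r` is itself the slack. This is what makes balls open.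
<-slack : ∀ {u r} → u <ℝ r →
          ∃ λ ε → 0ℝ <ℝ ε × (∀ {v w} → v <ℝ ε → w ≤ℝ u +ℝ v → w <ℝ r)
<-slack {u} {r} (ε , 0<ε , u<r) = constℝ ε , constℝ-pos 0<ε ,
  λ {v} {w} (η , 0<η , v<ε) w≤u+v → ½ ℚ.* η , half-pos 0<η ,
    ∧ᵉ-map
      (λ {n} h₁ (h₂ , h₃) →
        <-linear (seq w n ℚ.+ ½ ℚ.* η) (seq r n) (ℚ.+-mono-< h₁ (ℚ.+-mono-< h₂ h₃))
          (solve 6 (λ u v w r ε η →
              w :+ con ½ :* η :+ (con ½ :* η :+ (ε :+ r))
                := r :+ (w :- (u :+ v) :+ (v :+ η :+ (u :+ ε))))
            ≡.refl (seq u n) (seq v n) (seq w n) (seq r n) ε η))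
      (w≤u+v (½ ℚ.* η) (half-pos 0<η))
      (∧ᵉ-map _,_ v<ε u<r)

-- From `N` on, the sequence oscillates by less than ε/4. If its value at `N` is below ε/2, all
-- later values are below ε; otherwise they all exceed ε/4, and `u` would be positive.
≯0⇒≤0 : ∀ {u} → ¬ 0ℝ <ℝ u → u ≤ℝ 0ℝ
≯0⇒≤0 {u} u≯0 ε 0<ε = N , small
  where
  h q : ℚ
  h = ½ ℚ.* ε
  q = ½ ℚ.* h

  0<h = half-pos 0<ε
  0<q = half-pos 0<h
  N   = proj₁ (cauchy u q 0<q)

  oscillation : ∀ {m n} → N ℕ.≤ m → N ℕ.≤ n → seq u m ℚ.- seq u n ℚ.< q
  oscillation {m} {n} N≤m N≤n =
    ℚ.≤-<-trans (p≤∣p∣ _) (proj₂ (cauchy u q 0<q) m n N≤m N≤n)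
    where
    p≤∣p∣ : ∀ p → p ℚ.≤ ℚ.∣ p ∣
    p≤∣p∣ p with ℚ.≤-total 0ℚ p
    ... | inj₁ 0≤p = ℚ.≤-reflexive (≡.sym (ℚ.0≤p⇒∣p∣≡p 0≤p))
    ... | inj₂ p≤0 = ℚ.≤-trans p≤0 (ℚ.0≤∣p∣ p)

  small : ∀ n → N ℕ.≤ n → seq u n ℚ.- 0ℚ ℚ.< ε
  small n N≤n with seq u N ℚ.<? h
  ... | yes uN<h = <-linear (seq u n ℚ.- 0ℚ) ε
    (ℚ.+-mono-< uN<h (ℚ.+-mono-< (oscillation N≤n ℕ.≤-refl) 0<q))
    (solve 3 (λ uN un ε →
        un :- con 0ℚ :+ (con ½ :* ε :+ (con ½ :* (con ½ :* ε) :+ con ½ :* (con ½ :* ε)))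
          := ε :+ (uN :+ (un :- uN :+ con 0ℚ)))
      ≡.refl (seq u N) (seq u n) ε)
  ... | no uN≮h = ⊥-elim (u≯0 (q , 0<q , N , λ k N≤k →
    <-linear (0ℚ ℚ.+ q) (seq u k)
      (ℚ.+-mono-≤-< (ℚ.≮⇒≥ uN≮h) (oscillation ℕ.≤-refl N≤k))
      (solve 3 (λ uN uk ε →
          con 0ℚ :+ con ½ :* (con ½ :* ε) :+ (uN :+ con ½ :* (con ½ :* ε))
            := uk :+ (con ½ :* ε :+ (uN :- uk)))
        ≡.refl (seq u N) (seq u k) ε)))

-- Cofinal subsets of ℵ₁

module Cofinality (em : ∀ {p} → ExcludedMiddle p)
                  (Ω : StrictTotalOrder o₁ o₂ o₃) (Ω-isAleph₁ : IsAleph₁ Ω) where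
  open StrictTotalOrder Ω
  open IsAleph₁ Ω-isAleph₁

  Bounded : Pred Carrier p → Set _
  Bounded X = ∃ λ β → ∀ {α} → α ∈ X → α < β

  -- In a strict total order, `¬ α < β` says that β ≤ α.
  Cofinal : Pred Carrier p → Set _
  Cofinal X = ∀ β → ∃ λ α → α ∈ X × ¬ α < β

  -- This stands in for countability of `I`: it is regularity of ℵ₁ for families indexed by `I`, and
  -- it passes to products by iterated bounds instead of codings.
  Dominated : Set p → Set _
  Dominated I = ∀ (γ : I → Carrier) → ∃ λ β → ∀ i → γ i < β

  ¬Bounded⇒Cofinal : {X : Pred Carrier p} → ¬ Bounded X → Cofinal X
  ¬Bounded⇒Cofinal {X = X} unbounded β with em {P = ∃ λ α → α ∈ X × ¬ α < β}
  ... | yes α = α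
  ... | no ¬α = ⊥-elim (unbounded (β , below))
    where
    below : ∀ {α} → α ∈ X → α < β
    below {α} α∈X with α <? β
    ... | yes α<β = α<β
    ... | no  α≮β = ⊥-elim (¬α (α , α∈X , α≮β))

  Cofinal-⊆ : {X Y : Pred Carrier p} → X ⊆ Y → Cofinal X → Cofinal Y
  Cofinal-⊆ X⊆Y X! β with α , α∈X , α≮β ← X! β = α , X⊆Y α∈X , α≮β

  <-≮-trans : ∀ {α β γ} → α < β → ¬ γ < β → α < γ
  <-≮-trans {α} {β} {γ} α<β γ≮β with compare β γ
  ... | tri< β<γ _ _ = trans α<β β<γ
  ... | tri≈ _ β≈γ _ = <-respʳ-≈ β≈γ α<β
  ... | tri> _ _ γ<β = ⊥-elim (γ≮β γ<β)

  Cofinal-above : {X : Pred Carrier p} → Cofinal X → ∀ γ β →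
                  ∃ λ α → α ∈ X × ¬ α < γ × ¬ α < β
  Cofinal-above X! γ β with γ <? β
  ... | yes γ<β with α , α∈X , α≮β ← X! β =
    α , α∈X , (λ α<γ → α≮β (trans α<γ γ<β)) , α≮β
  ... | no γ≮β with α , α∈X , α≮γ ← X! γ = α , α∈X , α≮γ , λ α<β → α≮γ (<-≮-trans α<β γ≮β)

  inhabitant : Carrier
  inhabitant with em {P = Carrier}
  ... | yes α = α
  ... | no ¬α = ⊥-elim (uncountable (record
    { to = ⊥-elim ∘ ¬α ; cong = λ {α} → ⊥-elim (¬α α) ; injective = λ {α} → ⊥-elim (¬α α) }))

  -- If no β exceeds all γ n, then every β lies in one of the countable
  -- sets {β ≤ γ n}, so ℵ₁ is countable.
  dominated-ℕ : Dominated ℕ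
  dominated-ℕ γ with em {P = ∃ λ β → ∀ n → γ n < β}
  ... | yes β = β
  ... | no ¬β = ⊥-elim (uncountable
    (countable-by-relation em Eq.setoid R total R-resp R-injective))
    where
    code : ∀ n → Σ Carrier (_< γ n) → ℕ
    code n = Injection.to (segmentsCountable (γ n))

    -- A number records some `n` with β ≤ γ n and the code of β below γ n. These codes are shifted
    -- by `suc`, which leaves 0 for β ≈ γ n. One β may have many such `n`, so this is a relation and
    -- not a function.
    data R (β : Carrier) (k : ℕ) : Set (o₁ ⊔ o₂ ⊔ o₃) where
      below : ∀ n (β<γ : β < γ n) → k ≡ pair n (suc (code n (β , β<γ))) → R β k
      at    : ∀ n → β ≈ γ n → k ≡ pair n 0 → R β k

    total : ∀ β → ∃ (R β)
    total β with em {P = ∃ λ n → ¬ γ n < β}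
    ... | no ¬n = ⊥-elim (¬β (β , above))
      where
      above : ∀ n → γ n < β
      above n with γ n <? β
      ... | yes γ<β = γ<β
      ... | no  γ≮β = ⊥-elim (¬n (n , γ≮β))
    ... | yes (n , γ≮β) with compare β (γ n)
    ... | tri< β<γ _ _ = _ , below n β<γ ≡.refl
    ... | tri≈ _ β≈γ _ = _ , at n β≈γ ≡.refl
    ... | tri> _ _ γ<β = ⊥-elim (γ≮β γ<β)

    R-resp : ∀ {k} → (λ β → R β k) Respects _≈_
    R-resp β≈β′ (below n β<γ eq) = below n (<-respˡ-≈ β≈β′ β<γ)
      (≡.trans eq (≡.cong (pair n ∘ suc)
        (Injection.cong (segmentsCountable (γ n)) β≈β′)))
    R-resp β≈β′ (at n β≈γ eq) = at n (Eq.trans (Eq.sym β≈β′) β≈γ) eq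

    R-injective : ∀ {β β′ k} → R β k → R β′ k → β ≈ β′
    R-injective (below m β<γ eq) (below n β′<γ eq′)
      with pair-injective {m} {_} {n} (≡.trans (≡.sym eq) eq′)
    ... | ≡.refl , eq″ =
      Injection.injective (segmentsCountable (γ m)) (ℕ.suc-injective eq″)
    R-injective (below m _ eq) (at n _ eq′)
      with () ← proj₂ (pair-injective {m} {_} {n} (≡.trans (≡.sym eq) eq′))
    R-injective (at m _ eq) (below n _ eq′)
      with () ← proj₂ (pair-injective {m} {_} {n} (≡.trans (≡.sym eq) eq′))
    R-injective (at m β≈γ eq) (at n β′≈γ eq′)
      with pair-injective {m} {_} {n} (≡.trans (≡.sym eq) eq′)
    ... | ≡.refl , _ = Eq.trans β≈γ (Eq.sym β′≈γ)

  -- Bound each row over `J` first, then bound these row bounds over `I`.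
  dominated-× : {I : Set p} {J : Set c} → Dominated I → Dominated J → Dominated (I × J)
  dominated-× I! J! γ with β , β! ← I! (λ i → proj₁ (J! λ j → γ (i , j))) =
    β , λ (i , j) → trans (proj₂ (J! _) j) (β! i)

  dominated-Vec : {I : Set p} → Dominated I → ∀ n → Dominated (Vec I n)
  -- A constant sequence yields an index strictly above its single value.
  dominated-Vec I! zero    γ with β , β! ← dominated-ℕ (λ _ → γ []) =
    β , λ { [] → β! 0 }
  dominated-Vec I! (suc n) γ
    with β , β! ← dominated-× I! (dominated-Vec I! n) (λ (i , is) → γ (i ∷ is)) =
    β , λ { (i ∷ is) → β! (i , is) }

  -- Take β above chosen bounds of all the bounded pieces. A piece with a point at or beyond β
  -- cannot be one of these, so it is unbounded and hence cofinal.
  pieces-cofinal : {I : Set p} → Dominated I → (X : I → Pred Carrier c) →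
    ∃ λ β → ∀ i {α} → α ∈ X i → ¬ α < β → Cofinal (X i)
  pieces-cofinal I! X = proj₁ sup , λ i α∈X α≮β → ¬Bounded⇒Cofinal λ bounded →
    α≮β (trans (proj₂ (bound (X i)) bounded α∈X) (proj₂ sup i))
    where
    -- The bound is chosen for every piece, with an arbitrary default for unbounded ones, so that
    -- the bounds form a family over all of `I`.
    bound : (Y : Pred Carrier c) → ∃ λ β → Bounded Y → ∀ {α} → α ∈ Y → α < β
    bound Y with em {P = Bounded Y}
    ... | yes (β , Y<β)  = β , λ _ → Y<β
    ... | no  unbounded = inhabitant , λ bounded → ⊥-elim (unbounded bounded)

    sup = I! (λ i → proj₁ (bound (X i)))

-- Topology of Polish groups

-- A network in the sense of general topology: like a base, but with members that may fail to be
-- open.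
HasNetwork : {S : Setoid c ℓ} → Topology S → Set → Set (lsuc (c ⊔ ℓ))
HasNetwork {c} {ℓ} {S} τ I = ∃ λ (𝔅 : I → Pred (Setoid.Carrier S) (c ⊔ ℓ)) →
  ∀ {U x} → Open τ U → x ∈ U → ∃ λ i → x ∈ 𝔅 i × 𝔅 i ⊆ U

record OpenBox {S : Setoid c ℓ} (τ : Topology S) (V : Set) : Set (lsuc (c ⊔ ℓ)) where
  field
    side : V → Pred (Setoid.Carrier S) (c ⊔ ℓ)
    open-side : ∀ v → Open τ (side v)

  Contains : (V → Setoid.Carrier S) → Set (c ⊔ ℓ)
  Contains ρ = ∀ v → ρ v ∈ side v

open OpenBox

module _ {S : Setoid c ℓ} {τ : Topology S} {V : Set} where
  private module τ = Topology τ

  full-box : OpenBox τ V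
  full-box = record { side = λ _ _ → ⊤ ; open-side = λ _ → τ.open-full }

  infixr 7 _∩ᵇ_

  _∩ᵇ_ : OpenBox τ V → OpenBox τ V → OpenBox τ V
  A ∩ᵇ B = record
    { side      = λ v → side A v ∩ side B v
    ; open-side = λ v → τ.open-∩ (open-side A v) (open-side B v)
    }

module MetricTopology {S : Setoid c ℓ} (τ : Topology S)
                      (metrizable : CompletelyMetrizable τ) where
  open Setoid S using (Carrier; _≈_)

  d : Carrier → Carrier → ℝ
  d = proj₁ metrizable

  open IsGeneralMetric (proj₁ (proj₂ metrizable)) hiding (refl)

  open⇒metricOpen : ∀ {U} → Open τ U → MetricOpen S d U
  open⇒metricOpen {U} = Equivalence.to (proj₂ (proj₂ (proj₂ metrizable)) U)

  metricOpen⇒open : ∀ {U} → MetricOpen S d U → Open τ U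
  metricOpen⇒open {U} = Equivalence.from (proj₂ (proj₂ (proj₂ metrizable)) U)

  d-refl : ∀ {x y q} → x ≈ y → 0ℚ ℚ.< q → d x y <ℝ constℝ q
  d-refl {x} {y} x≈y = ≃0⇒<const {d x y} (≈⇒0 x≈y)

  Ball : Carrier → ℝ → Pred Carrier (c ⊔ ℓ)
  Ball x r y = Lift (c ⊔ ℓ) (d x y <ℝ r)

  ball-open : ∀ x r → Open τ (Ball x r)
  ball-open x r = metricOpen⇒open λ y (lift dxy<r) →
    let ε , 0<ε , slack = <-slack {d x y} {r} dxy<r
    in  ε , 0<ε , λ z dyz<ε → lift (slack {d y z} {d x z} dyz<ε (triangle x y z))

  -- The ball around `y` of radius `d y x` misses every point equal to `x`.
  ≉-open : (∀ {p} → ExcludedMiddle p) → ∀ x → Open τ (λ y → Lift (c ⊔ ℓ) (¬ y ≈ x))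
  ≉-open em x = metricOpen⇒open λ y (lift y≉x) →
    d y x , positive y≉x , λ z dyz<dyx → lift λ z≈x →
      <⇒≱ {d y z} {d y x} dyz<dyx
        (≃⇒≤ {d y x} {d y z} (cong (Setoid.refl S) (Setoid.sym S z≈x)))
    where
    positive : ∀ {y} → ¬ y ≈ x → 0ℝ <ℝ d y x
    positive {y} y≉x with em {P = 0ℝ <ℝ d y x}
    ... | yes 0<d = 0<d
    ... | no  0≮d = ⊥-elim (y≉x (0⇒≈
      (≤-antisym {d y x} {0ℝ} (≯0⇒≤0 {d y x} 0≮d) nonNegative)))

  -- The members are balls around points of the dense set, with rational radii. Inside an ε-ball
  -- around `x`, choose `q` by `<-halving` and a dense point `z` within `q` of `x`; the `q`-ball
  -- around `z` contains `x` and stays inside.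
  network : Separable τ → HasNetwork τ (ℕ × ℕ × ℕ)
  network (D , D-countable , D-dense) = 𝔅 , refine
    where
    module D = Injection D-countable

    -- The centre is given by its code `n`. If `n` codes no point of `D` the set is empty, and two
    -- centres with the same code are equal.
    𝔅 : ℕ × ℕ × ℕ → Pred Carrier (c ⊔ ℓ)
    𝔅 (n , a , b) y = Σ (Σ Carrier D) λ x →
      D.to x ≡ n × Lift (c ⊔ ℓ) (d (proj₁ x) y <ℝ constℝ (fraction a b))

    member : ∀ {x z q a b} (z∈D : z ∈ D) → fraction a b ≡ q →
             d x z <ℝ constℝ q → x ∈ 𝔅 (D.to (z , z∈D) , a , b)
    member {x} {z} {q} z∈D ≡.refl dxz<q = (z , z∈D) , ≡.refl ,
      lift (<-respˡ-≃ {d x z} {d z x} {constℝ q} (sym x z) dxz<q)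

    near : ∀ {y z q a b} (z∈D : z ∈ D) → fraction a b ≡ q →
           y ∈ 𝔅 (D.to (z , z∈D) , a , b) → d z y <ℝ constℝ q
    near {y} {z} {q} z∈D ≡.refl ((z′ , _) , eq , lift dz′y<q) =
      <-respˡ-≃ {d z′ y} {d z y} {constℝ q} (cong (D.injective eq) (Setoid.refl S)) dz′y<q

    refine : ∀ {U x} → Open τ U → x ∈ U → ∃ λ i → x ∈ 𝔅 i × 𝔅 i ⊆ U
    refine {U} {x} U! x∈U =
      let ε , 0<ε , ball⊆U = open⇒metricOpen U! x x∈U
          q , 0<q , halving = <-halving {ε} 0<ε
          a , b , r≡q = fraction-surjective 0<q
          z , lift dxz<q , z∈D = D-dense (ball-open x (constℝ q))
            (x , lift (d-refl (Setoid.refl S) 0<q))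
      in  (D.to (z , z∈D) , a , b) , member {x} {z} {q} {a} {b} z∈D r≡q dxz<q ,
          λ {y} y∈𝔅 → ball⊆U y
            (halving {d x z} {d z y} {d x y} dxz<q
              (near {y} {z} {q} {a} {b} z∈D r≡q y∈𝔅) (triangle x z y))

-- Quantifier-free formulas

module _ {G : Group c ℓ} {τ : Topology (Group.setoid G)}
         (isTopologicalGroup : IsTopologicalGroup G τ) where
  open Group G using (Carrier)
  open IsTopologicalGroup isTopologicalGroup
  open Semantics G using (⟦_⟧)
  private module τ = Topology τ

  term-continuous : (∀ {p} → ExcludedMiddle p) → {V : Set} (t : Term V) →
    ∀ {ρ O} → Open τ O → ⟦ t ⟧ ρ ∈ O →
    ∃ λ (B : OpenBox τ V) → Contains B ρ × (∀ {ρ′} → Contains B ρ′ → ⟦ t ⟧ ρ′ ∈ O)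
  term-continuous em {V} (var v) {ρ} {O} O! ρv∈O =
    record { side = side′ ; open-side = open-side′ }
    , (λ { _ ≡.refl → ρv∈O })
    , λ ρ′∈ → ρ′∈ v ≡.refl
    where
    -- The side is `O` at `v` and the whole group at every other variable.
    side′ : V → Pred Carrier (c ⊔ ℓ)
    side′ w x = v ≡ w → x ∈ O

    open-side′ : ∀ w → Open τ (side′ w)
    open-side′ w with em {P = v ≡ w}
    ... | yes v≡w = τ.resp-≐ ((λ x∈O _ → x∈O) , (λ x∈ → x∈ v≡w)) O!
    ... | no  v≢w = τ.resp-≐ ((λ _ v≡w → ⊥-elim (v≢w v≡w)) , _) τ.open-full
  term-continuous em e O! e∈O = full-box , _ , λ _ → e∈O
  term-continuous em (s · t) {ρ} O! st∈O =
    let U , W , U! , W! , s∈U , t∈W , U×W⊆O =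
          ∙-continuous O! (⟦ s ⟧ ρ) (⟦ t ⟧ ρ) st∈O
        A , ρ∈A , A⊆U = term-continuous em s U! s∈U
        B , ρ∈B , B⊆W = term-continuous em t W! t∈W
    in  A ∩ᵇ B , (λ v → ρ∈A v , ρ∈B v) ,
        λ ρ′∈ → U×W⊆O (A⊆U (proj₁ ∘ ρ′∈)) (B⊆W (proj₂ ∘ ρ′∈))
  term-continuous em (t ⁻¹) O! t⁻¹∈O = term-continuous em t (⁻¹-continuous O!) t⁻¹∈O

  -- The equation holds exactly where `s · t ⁻¹` takes the value `G.ε`, so its failure is the
  -- preimage of the open complement of a point under a continuous word map.
  inequation-open : (∀ {p} → ExcludedMiddle p) → CompletelyMetrizable τ →
    {V : Set} (s t : Term V) → ∀ {ρ} → ¬ Semantics.Sat G (s == t) ρ →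
    ∃ λ (B : OpenBox τ V) → Contains B ρ ×
      (∀ {ρ′} → Contains B ρ′ → ¬ Semantics.Sat G (s == t) ρ′)
  inequation-open em metrizable s t {ρ} s≉t =
    let B , ρ∈B , B⊆ = term-continuous em (s · t ⁻¹)
          (MetricTopology.≉-open τ metrizable em G.ε)
          (lift λ st⁻¹≈ε → s≉t (GroupProperties.x∙y⁻¹≈ε⇒x≈y G _ _ st⁻¹≈ε))
    in  B , ρ∈B , λ {ρ′} ρ′∈B s≈t → lower (B⊆ ρ′∈B)
          (G.trans (G.∙-congʳ s≈t) (G.inverseʳ (⟦ t ⟧ ρ′)))
    where module G = Group G

-- Condensation and half graphs

module HalfGraph (em : ∀ {p} → ExcludedMiddle p) (G : PolishGroup c ℓ)
                 (Ω : StrictTotalOrder o₁ o₂ o₃) (Ω-isAleph₁ : IsAleph₁ Ω) where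
  open PolishGroup G
  open Semantics group using (Sat)
  open StrictTotalOrder Ω using (Carrier; _<_; irrefl; module Eq)
  open Cofinality em Ω Ω-isAleph₁

  private Elt = Group.Carrier group

  Meets : ∀ {n} → (Carrier → Fin n → Elt) → OpenBox topology (Fin n) → Set _
  Meets a A = Cofinal λ α → Contains A (a α)

  -- From γ on, every term is a condensation point of the whole sequence.
  CondensesFrom : ∀ {n} → (Carrier → Fin n → Elt) → Carrier → Set _
  CondensesFrom {n} a γ = ∀ {α} → ¬ α < γ →
    {A : OpenBox topology (Fin n)} → Contains A (a α) → Meets a A

  -- Each product of `n` network members gives a piece, the set of indices whose terms it contains,
  -- and `pieces-cofinal` supplies γ. A box around a term beyond γ contains such a product around
  -- that term; its piece is cofinal, and so the box meets the sequence cofinally.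
  eventually-condenses : ∀ {n} (a : Carrier → Fin n → Elt) → ∃ (CondensesFrom a)
  eventually-condenses {n} a =
    let γ , γ! = pieces-cofinal (dominated-Vec
                   (dominated-× dominated-ℕ (dominated-× dominated-ℕ dominated-ℕ)) n)
                   (λ is α → ∀ i → a α i ∈ 𝔅 (lookup is i))
    in  γ , λ {α} α≮γ {A} aα∈A →
      let index = λ i → proj₁ (refine (open-side A i) (aα∈A i))
          a∈𝔅 = λ i → proj₁ (proj₂ (refine (open-side A i) (aα∈A i)))
          𝔅⊆A : ∀ i → 𝔅 (index i) ⊆ side A i
          𝔅⊆A i = proj₂ (proj₂ (refine (open-side A i) (aα∈A i)))
          index≡ = lookup∘tabulate index
      in  Cofinal-⊆
            (λ {α′} α′∈ i → 𝔅⊆A i (≡.subst (λ j → a α′ i ∈ 𝔅 j) (index≡ i) (α′∈ i)))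
            (γ! (tabulate index)
              (λ i → ≡.subst (λ j → a α i ∈ 𝔅 j) (≡.sym (index≡ i)) (a∈𝔅 i)) α≮γ)
    where
    𝔅-network = MetricTopology.network topology completelyMetrizable separable
    𝔅 = proj₁ 𝔅-network
    refine : ∀ {U x} → Open topology U → x ∈ U → ∃ λ i → x ∈ 𝔅 i × 𝔅 i ⊆ U
    refine = proj₂ 𝔅-network

  Caught : ∀ {n} → (Carrier → Fin n → Elt) → Carrier → OpenBox topology (Fin n) → Set _
  Caught a γ A = Σ Carrier λ α → ¬ α < γ × Contains A (a α)

  module _ {m n : ℕ} {a : Carrier → Fin m → Elt} {b : Carrier → Fin n → Elt} {γa γb : Carrier}
           (a-condenses : CondensesFrom a γa) (b-condenses : CondensesFrom b γb) where

    Holds : QFFormula (Fin m ⊎ Fin n) → Carrier → Carrier → Set ℓ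
    Holds φ α β = Sat φ [ a α , b β ]

    -- One implication suffices, since exchanging the two pairs gives the converse.
    ConstantOn : OpenBox topology (Fin m) → OpenBox topology (Fin n) →
                 QFFormula (Fin m ⊎ Fin n) → Set _
    ConstantOn A B φ =
      (x x′ : Caught a γa A) (y y′ : Caught b γb B) →
      Holds φ (proj₁ x) (proj₁ y) → Holds φ (proj₁ x′) (proj₁ y′)

    record Refinement (A : OpenBox topology (Fin m)) (B : OpenBox topology (Fin n))
                      (φ : QFFormula (Fin m ⊎ Fin n)) : Set (lsuc (c ⊔ ℓ) ⊔ o₁ ⊔ o₃) where
      field
        A′       : OpenBox topology (Fin m)
        B′       : OpenBox topology (Fin n)
        A′-meets : Meets a A′
        B′-meets : Meets b B′
        A′⊆A     : ∀ x → Contains A′ x → Contains A x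
        B′⊆B     : ∀ y → Contains B′ y → Contains B y
        constant : ConstantOn A′ B′ φ

    open Refinement

    widen-a : ∀ {A B φ} (R : Refinement A B φ) → Caught a γa (A′ R) → Caught a γa A
    widen-a R (α , α≮γ , α∈A′) = α , α≮γ , A′⊆A R (a α) α∈A′

    widen-b : ∀ {A B φ} (R : Refinement A B φ) → Caught b γb (B′ R) → Caught b γb B
    widen-b R (β , β≮γ , β∈B′) = β , β≮γ , B′⊆B R (b β) β∈B′

    map-constant : ∀ φ ψ {A B} → (∀ A′ B′ → ConstantOn A′ B′ φ → ConstantOn A′ B′ ψ) →
                   Refinement A B φ → Refinement A B ψ
    map-constant φ ψ f R =
      record { Refinement R hiding (constant) ; constant = f (A′ R) (B′ R) (constant R) }

    refine : ∀ φ A B → Meets a A → Meets b B → Refinement A B φ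

    -- Refine for `φ`, then refine the result for `ψ`. Constancy of `φ` survives because indices
    -- caught by the smaller boxes are caught by the larger ones.
    refine-both : ∀ φ ψ χ → (∀ A B → ConstantOn A B φ → ConstantOn A B ψ → ConstantOn A B χ) →
                  ∀ A B → Meets a A → Meets b B → Refinement A B χ
    refine-both φ ψ χ f A B A! B! =
      let R = refine φ A B A! B!
          S = refine ψ (A′ R) (B′ R) (A′-meets R) (B′-meets R)
      in  record
        { A′       = A′ S
        ; B′       = B′ S
        ; A′-meets = A′-meets S
        ; B′-meets = B′-meets S
        ; A′⊆A     = λ x → A′⊆A R x ∘ A′⊆A S x
        ; B′⊆B     = λ y → B′⊆B R y ∘ B′⊆B S y
        ; constant = f (A′ S) (B′ S)
            (λ x x′ y y′ → constant R (widen-a S x) (widen-a S x′) (widen-b S y) (widen-b S y′))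
            (constant S)
        }

    refine-trivially : ∀ φ A B → ConstantOn A B φ → Meets a A → Meets b B → Refinement A B φ
    refine-trivially φ A B const A! B! = record
      { A′ = A ; B′ = B ; A′-meets = A! ; B′-meets = B!
      ; A′⊆A = λ _ x∈A → x∈A ; B′⊆B = λ _ y∈B → y∈B ; constant = const }

    -- The box `C` splits into a box around the a-term and one around the b-term. Both terms lie
    -- beyond their condensation thresholds, so the intersections with `A` and `B` still meet the
    -- sequences cofinally. As `φ` fails throughout, constancy is vacuous.
    refine-around : ∀ φ A B →
      (x : Caught a γa A) (y : Caught b γb B) (C : OpenBox topology (Fin m ⊎ Fin n)) →
      Contains C [ a (proj₁ x) , b (proj₁ y) ] → (∀ {ρ} → Contains C ρ → ¬ Sat φ ρ) →
      Refinement A B φ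
    refine-around φ A B (α , α≮γ , α∈A) (β , β≮γ , β∈B) C αβ∈C C-fails = record
      { A′       = A ∩ᵇ Cₗ
      ; B′       = B ∩ᵇ Cᵣ
      ; A′-meets = a-condenses α≮γ {A ∩ᵇ Cₗ} (λ i → α∈A i , αβ∈C (inj₁ i))
      ; B′-meets = b-condenses β≮γ {B ∩ᵇ Cᵣ} (λ j → β∈B j , αβ∈C (inj₂ j))
      ; A′⊆A     = λ _ x∈ → proj₁ ∘ x∈
      ; B′⊆B     = λ _ y∈ → proj₁ ∘ y∈
      ; constant = λ (α , _ , α∈) _ (β , _ , β∈) _ φαβ → ⊥-elim (C-fails {[ a α , b β ]}
          (λ { (inj₁ i) → proj₂ (α∈ i) ; (inj₂ j) → proj₂ (β∈ j) }) φαβ)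
      }
      where
      Cₗ : OpenBox topology (Fin m)
      Cₗ = record { side = side C ∘ inj₁ ; open-side = open-side C ∘ inj₁ }

      Cᵣ : OpenBox topology (Fin n)
      Cᵣ = record { side = side C ∘ inj₂ ; open-side = open-side C ∘ inj₂ }

    refine (s == t) A B A! B!
      with em {P = Σ (Caught a γa A) λ x → Σ (Caught b γb B) λ y →
                     ¬ Holds (s == t) (proj₁ x) (proj₁ y)}
    ... | no never-fails = refine-trivially (s == t) A B always A! B!
      where
      always : ConstantOn A B (s == t)
      always _ x′ _ y′ _ with em {P = Holds (s == t) (proj₁ x′) (proj₁ y′)}
      ... | yes s≈t = s≈t
      ... | no  s≉t = ⊥-elim (never-fails (x′ , y′ , s≉t))
    ... | yes (x , y , s≉t) =
      let C , xy∈C , C-fails = inequation-open isTopologicalGroup em completelyMetrizable s t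
                                 {[ a (proj₁ x) , b (proj₁ y) ]} s≉t
      in  refine-around (s == t) A B x y C xy∈C C-fails
    refine ⊤′ A B = refine-trivially ⊤′ A B λ _ _ _ _ _ → tt
    refine ⊥′ A B = refine-trivially ⊥′ A B λ { _ _ _ _ () }
    -- Negation reverses the implication, so the constancy of `φ` is used with the pairs exchanged;
    -- the premise of `→′` below is treated alike.
    refine (¬′ φ) A B A! B! = map-constant φ (¬′ φ)
      (λ _ _ φ! x x′ y y′ ¬φ φ′ → ¬φ (φ! x′ x y′ y φ′))
      (refine φ A B A! B!)
    refine (φ ∧′ ψ) = refine-both φ ψ (φ ∧′ ψ)
      λ _ _ φ! ψ! x x′ y y′ (p , q) → φ! x x′ y y′ p , ψ! x x′ y y′ q
    refine (φ ∨′ ψ) = refine-both φ ψ (φ ∨′ ψ)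
      λ _ _ φ! ψ! x x′ y y′ → Sum.map (φ! x x′ y y′) (ψ! x x′ y y′)
    refine (φ →′ ψ) = refine-both φ ψ (φ →′ ψ)
      λ _ _ φ! ψ! x x′ y y′ f p → ψ! x x′ y y′ (f (φ! x′ x y′ y p))

  no-half-graph : ∀ {m n} (φ : QFFormula (Fin m ⊎ Fin n)) → ¬ DefinesHalfGraph group Ω φ
  no-half-graph {m} {n} φ (aᶠ , bᶠ , φ⇔<) =
    let γa , a! = eventually-condenses a
        γb , b! = eventually-condenses b
        R = refine a! b! φ full-box full-box (full-meets a) (full-meets b)
        open Refinement R
        -- The indices are chosen with β ≤ α < β′. Then `φ` holds at (α, β′), and constancy carries
        -- it to (α, β), forcing α < β.
        β  , β∈  , β≮γ  , _    = Cofinal-above B′-meets γb γb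
        α  , α∈  , α≮γ  , α≮β  = Cofinal-above A′-meets γa β
        -- Cofinality only gives weak inequalities, so an index strictly above α is needed to make α
        -- < β′ strict.
        α⁺ , α<α⁺ = dominated-ℕ (λ _ → α)
        β′ , β′∈ , β′≮γ , β′≮α⁺ = Cofinal-above B′-meets γb α⁺
    in α≮β (Equivalence.to (φ⇔< α β)
         (constant (α , α≮γ , α∈) (α , α≮γ , α∈) (β′ , β′≮γ , β′∈) (β , β≮γ , β∈)
           (Equivalence.from (φ⇔< α β′) (<-≮-trans (α<α⁺ 0) β′≮α⁺))))
    where
    a : Carrier → Fin m → Elt
    a = Func.to aᶠ

    b : Carrier → Fin n → Elt
    b = Func.to bᶠ

    full-meets : ∀ {k} (x : Carrier → Fin k → Elt) → Meets x full-box
    full-meets _ β = β , _ , irrefl Eq.refl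

theorem1p1 : (em : ∀ {p} → ExcludedMiddle p) →
    ∀ {c ℓ o₁ o₂ o₃ : Level} (G : PolishGroup c ℓ) {m n : ℕ} (φ : QFFormula (Fin m ⊎ Fin n)) →
    ∀ (ℵ₁ : StrictTotalOrder o₁ o₂ o₃) → IsAleph₁ ℵ₁ →
    ¬ DefinesHalfGraph (PolishGroup.group G) ℵ₁ φ
theorem1p1 em G φ ℵ₁ ℵ₁-isAleph₁ = HalfGraph.no-half-graph em G ℵ₁ ℵ₁-isAleph₁ φ
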